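{- If $G$ is a twin-free cubic graph of (finite) order $n \ge 46$, then $\textrm{ERR:LD}(G) \le \left\lceil \frac{45}{46} n \right\rceil$.
   Context: Graphs are simple and undirected. A graph is cubic if it is 3-regular; its order is its number of vertices. $N(v)$ is the open neighborhood of $v$ and $N[v]=N(v)\cup\{v\}$. Two distinct vertices $u,v$ are twins if $N[u]=N[v]$ or $N(u)=N(v)$; a graph is twin-free if it has no twins. ERR:LD sets (error-correcting locating-dominating sets): $S \subseteq V(G)$ is a set of detectors. At most one intruder is present, located at some vertex. A correctly working detector $v\in S$ transmits $2$ if the intruder is at $v$, $1$ if the intruder is in $N(v)$, and $0$ otherwise. At most one detector may transmit an incorrect value. $S$ is an ERR:LD set if, from the transmitted values, one can always determine whether an intruder is present and, if so, its exact location. Equivalently: $|N[v] \cap S| \ge 3$ for all $v\in V(G)$, and $|((N(v) \cap S) \triangle (N(u) \cap S)) - \{v,u\}| \ge 3 - |\{v,u\}\cap S|$ for all distinct $u,v\in V(G)$. $\textrm{ERR:LD}(G)$ is the minimum cardinality of an ERR:LD set for $G$. -}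

module Defs where

open import Data.Bool using (if_then_else_)
open import Data.Fin using (Fin; _≟_)
open import Data.Fin.Patterns using (0F; 1F; 2F)
open import Data.Fin.Subset using (Subset; _∈_; _∉_; _∪_; ⁅_⁆; ∣_∣)
open import Data.Fin.Subset.Properties using (_∈?_)
open import Data.Maybe using (Maybe; just; nothing)
open import Data.Nat using (ℕ; _≤_)
open import Data.Product using (_×_; ∃-syntax)
open import Data.Sum using (_⊎_)
open import Relation.Binary.PropositionalEquality using (_≡_; _≢_)
open import Relation.Nullary using (¬_; does)

-- Simple undirected graphs with vertex set Fin n.  Adjacency is given by the
-- open neighbourhoods: u and v are adjacent iff u ∈ N v.
record Graph (n : ℕ) : Set where
  field
    N       : Fin n → Subset n
    N-sym   : ∀ {u v} → u ∈ N v → v ∈ N u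
    N-irrefl : ∀ {v} → v ∉ N v

  N[_] : Fin n → Subset n
  N[ v ] = ⁅ v ⁆ ∪ N v

  Cubic : Set
  Cubic = ∀ v → ∣ N v ∣ ≡ 3

  Twins : Fin n → Fin n → Set
  Twins u v = u ≢ v × (N[ u ] ≡ N[ v ] ⊎ N u ≡ N v)

  TwinFree : Set
  TwinFree = ∀ u v → ¬ Twins u v

  -- The location of the intruder; `nothing` means that no intruder is present.
  State : Set
  State = Maybe (Fin n)

  -- The value transmitted by a correctly working detector at v.
  signal : State → Fin n → Fin 3
  signal nothing  v = 0F
  signal (just x) v =
    if does (x ≟ v) then 2F else
    if does (x ∈? N v) then 1F else 0F

  -- The transmitted values t could have been received from the detectors S in
  -- state s, with at most one detector in error.  The values of t at vertices
  -- outside S are irrelevant.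
  Consistent : Subset n → State → (Fin n → Fin 3) → Set
  Consistent S s t =
    ∀ v w → v ∈ S → w ∈ S → t v ≢ signal s v → t w ≢ signal s w → v ≡ w

  IsERRLD : Subset n → Set
  IsERRLD S = ∀ t s s′ → Consistent S s t → Consistent S s′ t → s ≡ s′

  -- ERR:LD(G) = k.  This is a relation, not a function, because a general
  -- graph need not have any ERR:LD set.
  ERRLD≡ : ℕ → Set
  ERRLD≡ k = (∃[ S ] IsERRLD S × ∣ S ∣ ≡ k) × (∀ S → IsERRLD S → k ≤ ∣ S ∣)

{-# OPTIONS --safe #-}

-- Let X be a maximal set of vertices at pairwise distance at least 5 and let S
-- be its complement.  In a cubic graph a ball of radius 4 has at most
-- 1 + 3 * 15 = 46 vertices, and the balls of radius 4 around X cover the graph,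
-- so n ≤ 46 ∣X∣ and ∣S∣ ≤ 45n/46.  Two states are told apart as soon as their
-- signals differ at three detectors, so it is enough to find four vertices,
-- pairwise at distance at most 4, at which the signals differ: at most one of
-- them is outside S.  If one of the states is "no intruder", or the two
-- intruders u and v are at distance at least 3, then N[ u ] will do.
-- Otherwise take u, v, a vertex of N u outside N[ v ] and a vertex of N v
-- outside N[ u ], which exist because G is regular and twin-free.

module Submission where

open import Defs
open import Data.Nat using (ℕ; _≥_)
open import Data.Integer using (+_) renaming (_≤_ to _≤ℤ_)
open import Data.Rational using (_/_; _*_; ceiling)
open import Data.Product using (_×_; ∃-syntax)

open import Data.Fin using (Fin; zero; suc; _≟_; finToFun; funToFin)
open import Data.Fin.Patterns using (0F; 2F)
open import Data.Fin.Properties using (all?; any?; finToFun-funToFin; injective⇒≤; suc-injective)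
open import Data.Fin.Subset
  using (Subset; inside; outside; _∈_; _∉_; _⊆_; _∪_; _-_; ⁅_⁆; ⊤; ∣_∣)
open import Data.Fin.Subset.Properties
  using (_∈?_; anySubset?; ∈⊤; ∣⊤∣≡n; x∈⁅x⁆; x∈⁅y⁆⇒x≡y; x∈p∪q⁺; x∈p∪q⁻; ∪-identityˡ
        ; ⊆-antisym; p⊂q⇒∣p∣<∣q∣; x∈p∧x≢y⇒x∈p-y; x∈p⇒∣p-x∣<∣p∣)
import Data.Integer as ℤ
import Data.Integer.DivMod as ℤ
import Data.Integer.Properties as ℤ
open import Data.List using (List; []; _∷_; [_]; length; map; filter; foldr; concatMap; allFin)
open import Data.List.Membership.Propositional using (find; lose)
  renaming (_∈_ to _∈ₗ_; _∉_ to _∉ₗ_)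
open import Data.List.Membership.Propositional.Properties
  using (∈-allFin; ∈-map⁺; ∈-map⁻; ∈-filter⁺; ∈-filter⁻; ∈-concatMap⁺; ∈-concatMap⁻; ∈-AllPairs₂)
import Data.List.Membership.DecPropositional as DecMembership
open import Data.List.Membership.Setoid.Properties using (index-injective)
open import Data.List.Properties using (length-map; length-++; filter-all; filter-notAll)
open import Data.List.Relation.Unary.All as All using (All; []; _∷_)
open import Data.List.Relation.Unary.All.Properties using (¬Any⇒All¬; ¬All⇒Any¬; all-filter)
  renaming (filter⁺ to All-filter⁺)
open import Data.List.Relation.Unary.AllPairs as AllPairs using (AllPairs; []; _∷_)
open import Data.List.Relation.Unary.Any as Any using (Any; here; there)
open import Data.List.Relation.Unary.Unique.Propositional using (Unique)
open import Data.List.Relation.Unary.Unique.Propositional.Properties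
  using (Unique[x∷xs]⇒x∉xs) renaming (map⁺ to Unique-map⁺; filter⁺ to Unique-filter⁺)
open import Data.Maybe using (Maybe; just; nothing)
open import Data.Maybe.Properties using (≡-dec)
import Data.Nat as ℕ
open import Data.Nat using (suc; zero; z≤n; s≤s)
open import Data.Nat.Induction using (<-wellFounded)
import Data.Nat.Properties as ℕ
open import Data.Product using (_,_; proj₁)
import Data.Rational as ℚ
import Data.Rational.Properties as ℚ
open import Data.Rational.Unnormalised as ℚᵘ using (mkℚᵘ; *≤*)
import Data.Rational.Unnormalised.Properties as ℚᵘ
open import Data.Sum using (_⊎_; inj₁; inj₂)
open import Data.Vec using ([]; _∷_; here; there)
open import Function using (_∘_; case_of_)
open import Induction.WellFounded using (Acc; acc)
open import Relation.Binary.PropositionalEquality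
  using (_≡_; _≢_; _≗_; refl; sym; trans; cong; subst; subst₂; setoid; ≢-sym)
open import Relation.Nullary using (¬_; Dec; yes; no; ¬?; contradiction; _×-dec_; _→-dec_)
open import Relation.Nullary.Decidable using (map′; decidable-stable)
open import Relation.Unary using (Decidable)

private
  variable
    n : ℕ
    A B : Set

open module ∈-dec {n} = DecMembership (_≟_ {n}) using () renaming (_∈?_ to _∈ₗ?_)

-- Lists

length-concatMap-≤ : ∀ {c} (f : A → List B) {xs} → All (λ x → length (f x) ℕ.≤ c) xs →
                     length (concatMap f xs) ℕ.≤ length xs ℕ.* c
length-concatMap-≤ f []                 = z≤n
length-concatMap-≤ f {x ∷ _} (fx≤ ∷ f≤) = subst (ℕ._≤ _) (sym (length-++ (f x)))
  (ℕ.+-mono-≤ fx≤ (length-concatMap-≤ f f≤))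

-- If the head fails `P`, any other failing entry would equal it, against uniqueness; so the rest of
-- the list survives intact. Applied with `P` as membership in the detector set.
length≤1+length-filter : ∀ {P : A → Set} (P? : Decidable P) {xs} → Unique xs →
  (∀ {x y} → x ∈ₗ xs → y ∈ₗ xs → ¬ P x → ¬ P y → x ≡ y) →
  length xs ℕ.≤ suc (length (filter P? xs))
length≤1+length-filter P? {[]}     []          ≤1 = z≤n
length≤1+length-filter P? {x ∷ xs} (x∉xs ∷ uq) ≤1 with P? x
... | yes _  = s≤s (length≤1+length-filter P? uq (λ x∈ y∈ → ≤1 (there x∈) (there y∈)))
... | no ¬px = s≤s (ℕ.≤-reflexive (sym (cong length (filter-all P? (All.tabulate λ {y} y∈ →
    decidable-stable (P? y) λ ¬py → All.lookup x∉xs y∈ (≤1 (here refl) (there y∈) ¬px ¬py))))))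

-- Sending each vertex to a position where it occurs is injective.
complete⇒n≤length : (xs : List (Fin n)) → (∀ v → v ∈ₗ xs) → n ℕ.≤ length xs
complete⇒n≤length xs ∈xs = injective⇒≤ λ {u} {v} → index-injective (setoid _) (∈xs u) (∈xs v)

-- Subsets of Fin n

elements : Subset n → List (Fin n)
elements []            = []
elements (inside  ∷ p) = zero ∷ map suc (elements p)
elements (outside ∷ p) = map suc (elements p)

length-elements : (p : Subset n) → length (elements p) ≡ ∣ p ∣
length-elements []            = refl
length-elements (inside  ∷ p) = cong suc (trans (length-map suc (elements p)) (length-elements p))
length-elements (outside ∷ p) = trans (length-map suc (elements p)) (length-elements p)

∈-elements⁺ : {p : Subset n} {x : Fin n} → x ∈ p → x ∈ₗ elements p
∈-elements⁺ {p = inside  ∷ p} here        = here refl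
∈-elements⁺ {p = inside  ∷ p} (there x∈p) = there (∈-map⁺ suc (∈-elements⁺ x∈p))
∈-elements⁺ {p = outside ∷ p} (there x∈p) = ∈-map⁺ suc (∈-elements⁺ x∈p)

elements-∈ : (p : Subset n) → All (_∈ p) (elements p)
elements-∈ p = All.tabulate (∈-elements⁻ p)
  where
  ∈-elements⁻ : ∀ {n} (p : Subset n) {x} → x ∈ₗ elements p → x ∈ p
  ∈-elements⁻ (inside  ∷ p) (here refl) = here
  ∈-elements⁻ (inside  ∷ p) (there x∈)  with ∈-map⁻ suc x∈
  ... | _ , y∈ , refl = there (∈-elements⁻ p y∈)
  ∈-elements⁻ (outside ∷ p) x∈          with ∈-map⁻ suc x∈
  ... | _ , y∈ , refl = there (∈-elements⁻ p y∈)

elements-unique : (p : Subset n) → Unique (elements p)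
elements-unique []            = []
elements-unique (inside  ∷ p) =
  All.tabulate (λ x∈ 0≡x → case ∈-map⁻ suc (subst (_∈ₗ _) (sym 0≡x) x∈) of λ { (_ , _ , ()) })
  ∷ Unique-map⁺ suc-injective (elements-unique p)
elements-unique (outside ∷ p) = Unique-map⁺ suc-injective (elements-unique p)

∣⁅x⁆∪p∣≡1+∣p∣ : {x : Fin n} {p : Subset n} → x ∉ p → ∣ ⁅ x ⁆ ∪ p ∣ ≡ suc ∣ p ∣
∣⁅x⁆∪p∣≡1+∣p∣ {x = zero}  {inside  ∷ p} x∉p = contradiction here x∉p
∣⁅x⁆∪p∣≡1+∣p∣ {x = zero}  {outside ∷ p} x∉p = cong (suc ∘ ∣_∣) (∪-identityˡ p)
∣⁅x⁆∪p∣≡1+∣p∣ {x = suc x} {inside  ∷ p} x∉p = cong suc (∣⁅x⁆∪p∣≡1+∣p∣ (x∉p ∘ there))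
∣⁅x⁆∪p∣≡1+∣p∣ {x = suc x} {outside ∷ p} x∉p = ∣⁅x⁆∪p∣≡1+∣p∣ (x∉p ∘ there)

⊆∧∣∣≡⇒≡ : {p q : Subset n} → p ⊆ q → ∣ p ∣ ≡ ∣ q ∣ → p ≡ q
⊆∧∣∣≡⇒≡ {p = p} p⊆q ∣p∣≡∣q∣ = ⊆-antisym p⊆q λ {x} x∈q → decidable-stable (x ∈? p) λ x∉p →
  ℕ.<⇒≢ (p⊂q⇒∣p∣<∣q∣ (p⊆q , x , x∈q , x∉p)) ∣p∣≡∣q∣

excluding : List (Fin n) → Subset n
excluding = foldr (λ x p → p - x) ⊤

∈-excluding⁺ : ∀ {v : Fin n} xs → v ∉ₗ xs → v ∈ excluding xs
∈-excluding⁺ []       v∉xs = ∈⊤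
∈-excluding⁺ (x ∷ xs) v∉xs = x∈p∧x≢y⇒x∈p-y (∈-excluding⁺ xs (v∉xs ∘ there)) (v∉xs ∘ here)

-- As the entries are distinct, each deletion removes an element that is still present, so the size
-- drops at every step.
∣excluding∣ : {xs : List (Fin n)} → Unique xs → ∣ excluding xs ∣ ℕ.+ length xs ℕ.≤ n
∣excluding∣ {n} []                     = ℕ.≤-reflexive (trans (ℕ.+-identityʳ _) (∣⊤∣≡n n))
∣excluding∣ {n} {x ∷ xs} uq@(_ ∷ uq′) = begin
  ∣ excluding xs - x ∣ ℕ.+ suc (length xs)  ≡⟨ ℕ.+-suc _ (length xs) ⟩
  suc ∣ excluding xs - x ∣ ℕ.+ length xs    ≤⟨ ℕ.+-monoˡ-≤ (length xs)
                                                 (x∈p⇒∣p-x∣<∣p∣ x∈p) ⟩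
  ∣ excluding xs ∣ ℕ.+ length xs            ≤⟨ ∣excluding∣ uq′ ⟩
  n                                         ∎
  where
  open ℕ.≤-Reasoning
  x∈p : x ∈ excluding xs
  x∈p = ∈-excluding⁺ xs (Unique[x∷xs]⇒x∉xs uq)

-- Descent on cardinality: search all subsets for a strictly smaller one with `P`, and stop when
-- there is none.
smallest : {P : Subset n → Set} → Decidable P → ∀ S → P S →
           ∃[ T ] P T × (∀ U → P U → ∣ T ∣ ℕ.≤ ∣ U ∣)
smallest {P = P} P? S pS = go S pS (<-wellFounded _)
  where
  go : ∀ S → P S → Acc ℕ._<_ ∣ S ∣ → ∃[ T ] P T × (∀ U → P U → ∣ T ∣ ℕ.≤ ∣ U ∣)
  go S pS (acc rec) with anySubset? (λ T → P? T ×-dec (∣ T ∣ ℕ.<? ∣ S ∣))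
  ... | yes (T , pT , T<S) = go T pT (rec T<S)
  ... | no ∄smaller        = S , pS , λ U pU → ℕ.≮⇒≥ λ U<S → ∄smaller (U , pU , U<S)

all-Maybe? : {P : Maybe (Fin n) → Set} → Decidable P → Dec (∀ s → P s)
all-Maybe? P? = map′ (λ { (p , ps) nothing → p ; (p , ps) (just x) → ps x })
                     (λ ps → ps nothing , ps ∘ just)
                     (P? nothing ×-dec all? (P? ∘ just))

-- Locating-dominating sets

module _ (G : Graph n) where
  open Graph G

  Consistent? : ∀ S s t → Dec (Consistent S s t)
  Consistent? S s t = all? λ v → all? λ w → v ∈? S →-dec w ∈? S →-dec
    ¬? (t v ≟ signal s v) →-dec ¬? (t w ≟ signal s w) →-dec v ≟ w

  Consistent-cong : ∀ {S} s {t t′} → t ≗ t′ → Consistent S s t → Consistent S s t′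
  Consistent-cong s t≗t′ con v w v∈S w∈S v≢ w≢ =
    con v w v∈S w∈S (v≢ ∘ trans (sym (t≗t′ v))) (w≢ ∘ trans (sym (t≗t′ w)))

  -- Makes `smallest` applicable. The functions from `Fin n` to `Fin 3` are enumerated by their
  -- codes in a finite type; decoding returns a function only up to pointwise equality, hence
  -- `Consistent-cong`.
  IsERRLD? : Decidable IsERRLD
  IsERRLD? S = map′
    (λ err t s s′ c c′ → let t≗ = λ v → sym (finToFun-funToFin t v) in
      err (funToFin t) s s′ (Consistent-cong s t≗ c) (Consistent-cong s′ t≗ c′))
    (λ err i → err (finToFun i))
    (all? λ i → all-Maybe? λ s → all-Maybe? λ s′ →
      Consistent? S s (finToFun i) →-dec Consistent? S s′ (finToFun i) →-dec ≡-dec _≟_ s s′)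

  Differ : State → State → Fin n → Set
  Differ s s′ v = signal s v ≢ signal s′ v

  -- At each of the three detectors, one of the two states sees an error.
  three-differing : ∀ {S} s s′ {t xs} → 3 ℕ.≤ length xs → Unique xs → All (_∈ S) xs →
                    All (Differ s s′) xs → Consistent S s t → ¬ Consistent S s′ t
  three-differing s s′ {t} {x ∷ y ∷ z ∷ _} (s≤s (s≤s (s≤s _)))
    ((x≢y ∷ x≢z ∷ _) ∷ (y≢z ∷ _) ∷ _) (x∈ ∷ y∈ ∷ z∈ ∷ _) (dx ∷ dy ∷ dz ∷ _) c c′
    with error dx | error dy | error dz
    where
    error : ∀ {v} → Differ s s′ v → t v ≢ signal s v ⊎ t v ≢ signal s′ v
    error {v} d with t v ≟ signal s v
    ... | yes t≡ = inj₂ (d ∘ trans (sym t≡))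
    ... | no  t≢ = inj₁ t≢
  ... | inj₁ ex | inj₁ ey | _       = x≢y (c  _ _ x∈ y∈ ex ey)
  ... | inj₂ ex | inj₂ ey | _       = x≢y (c′ _ _ x∈ y∈ ex ey)
  ... | inj₁ ex | inj₂ ey | inj₁ ez = x≢z (c  _ _ x∈ z∈ ex ez)
  ... | inj₁ ex | inj₂ ey | inj₂ ez = y≢z (c′ _ _ y∈ z∈ ey ez)
  ... | inj₂ ex | inj₁ ey | inj₁ ez = y≢z (c  _ _ y∈ z∈ ey ez)
  ... | inj₂ ex | inj₁ ey | inj₂ ez = x≢z (c′ _ _ x∈ z∈ ex ez)

  signal-self : ∀ v → signal (just v) v ≡ 2F
  signal-self v with v ≟ v
  ... | yes _  = refl
  ... | no v≢v = contradiction refl v≢v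

  signal-other : ∀ u v → u ≢ v → signal (just u) v ≢ 2F
  signal-other u v u≢v with u ≟ v
  ... | yes u≡v = contradiction u≡v u≢v
  ... | no _ with u ∈? N v
  ...   | yes _ = λ ()
  ...   | no  _ = λ ()

  signal-near : ∀ u v → v ∈ N u → signal (just u) v ≢ 0F
  signal-near u v v∈Nu with u ≟ v
  ... | yes _ = λ ()
  ... | no _ with u ∈? N v
  ...   | yes _   = λ ()
  ...   | no u∉Nv = contradiction (N-sym v∈Nu) u∉Nv

  signal-far : ∀ u v → u ≢ v → v ∉ N u → signal (just u) v ≡ 0F
  signal-far u v u≢v v∉Nu with u ≟ v
  ... | yes u≡v = contradiction u≡v u≢v
  ... | no _ with u ∈? N v
  ...   | yes u∈Nv = contradiction (N-sym u∈Nv) v∉Nu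
  ...   | no _     = refl

  nbrs : Fin n → List (Fin n)
  nbrs v = elements (N v)

  v∷nbrs-unique : ∀ v → Unique (v ∷ nbrs v)
  v∷nbrs-unique v =
    All.map (λ w∈Nv v≡w → N-irrefl (subst (_∈ N v) (sym v≡w) w∈Nv)) (elements-∈ (N v))
    ∷ elements-unique (N v)

  signal-N[] : ∀ v → All (λ w → signal (just v) w ≢ 0F) (v ∷ nbrs v)
  signal-N[] v = (λ eq → case trans (sym (signal-self v)) eq of λ ())
               ∷ All.map (signal-near v _) (elements-∈ (N v))

  -- Walks and balls

  -- Walk k u v: there is a walk from u to v of length at most k.
  data Walk : ℕ → Fin n → Fin n → Set where
    stay : ∀ {k v} → Walk k v v
    step : ∀ {k u v w} → v ∈ N u → Walk k v w → Walk (suc k) u w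

  weaken : ∀ j {k u v} → Walk k u v → Walk (j ℕ.+ k) u v
  weaken j          stay = stay
  weaken j {suc k} {u} {v} (step w∈Nu walk) =
    subst (λ l → Walk l u v) (sym (ℕ.+-suc j k)) (step w∈Nu (weaken j walk))

  _++ʷ_ : ∀ {j k u v w} → Walk j u v → Walk k v w → Walk (j ℕ.+ k) u w
  _++ʷ_ {j} stay          w₂ = weaken j w₂
  step v∈Nu w₁ ++ʷ w₂ = step v∈Nu (w₁ ++ʷ w₂)

  reverse₁ : ∀ {u v} → Walk 1 u v → Walk 1 v u
  reverse₁ stay             = stay
  reverse₁ (step v∈Nu stay) = step (N-sym v∈Nu) stay

  reverse₂ : ∀ {u v} → Walk 2 u v → Walk 2 v u
  reverse₂ stay          = stay
  reverse₂ (step v∈Nu w) = reverse₁ w ++ʷ step (N-sym v∈Nu) stay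

  nbrs-walk : ∀ v → All (Walk 1 v) (v ∷ nbrs v)
  nbrs-walk v = stay ∷ All.map (λ w∈Nv → step w∈Nv stay) (elements-∈ (N v))

  signal-walk : ∀ u v → signal (just u) v ≢ 0F → Walk 1 u v
  signal-walk u v ≢0 with u ≟ v
  ... | yes refl = stay
  ... | no _ with u ∈? N v
  ...   | yes u∈Nv = step (N-sym u∈Nv) stay
  ...   | no _     = contradiction refl ≢0

  nbrs-without : Fin n → Fin n → List (Fin n)
  nbrs-without v w = filter (λ x → ¬? (x ≟ v)) (nbrs w)

  -- The end points of the non-backtracking walks of length at most k from v
  -- whose first step is to a member of ws.
  spread : ℕ → Fin n → List (Fin n) → List (Fin n)
  spread zero    v ws = [ v ]
  spread (suc k) v ws = v ∷ concatMap (λ w → spread k w (nbrs-without v w)) ws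

  ball : ℕ → Fin n → List (Fin n)
  ball k v = spread k v (nbrs v)

  centre∈spread : ∀ k {v} ws → v ∈ₗ spread k v ws
  centre∈spread zero    ws = here refl
  centre∈spread (suc k) ws = here refl

  branch⁺ : ∀ k {v w ws x} → w ∈ₗ ws → x ∈ₗ spread k w (nbrs-without v w) →
            x ∈ₗ spread (suc k) v ws
  branch⁺ k w∈ws x∈ = there (∈-concatMap⁺ _ (lose w∈ws x∈))

  -- Serves the backtracking case of `ball-step`, where the tail has two steps fewer and a
  -- restricted first step. Two applications restore the length, the first one also lifting the
  -- restriction.
  spread-mono : ∀ k {v} ws {ws′ x} → (∀ {w} → w ∈ₗ ws → w ∈ₗ ws′) →
                x ∈ₗ spread k v ws → x ∈ₗ spread (suc k) v ws′
  spread-mono zero    ws ws⊆ (here refl) = here refl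
  spread-mono (suc k) ws ws⊆ (here refl) = here refl
  spread-mono (suc k) {v} ws ws⊆ (there x∈)
    with w , w∈ws , x∈w ← find (∈-concatMap⁻ _ {xs = ws} x∈) =
    branch⁺ (suc k) (ws⊆ w∈ws) (spread-mono k (nbrs-without v w) (λ y∈ → y∈) x∈w)

  -- Prepending u to a non-backtracking walk from v gives another one, unless
  -- the walk returns to u at once; then its tail starts at u.
  ball-step : ∀ k {u v x} → v ∈ N u → x ∈ₗ ball k v → x ∈ₗ ball (suc k) u
  ball-step zero    v∈Nu (here refl) = branch⁺ zero (∈-elements⁺ v∈Nu) (here refl)
  ball-step (suc k) v∈Nu (here refl) = branch⁺ (suc k) (∈-elements⁺ v∈Nu) (here refl)
  ball-step (suc k) {u} {v} v∈Nu (there x∈)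
    with w , w∈ , x∈w ← find (∈-concatMap⁻ _ {xs = nbrs v} x∈)
    with w ≟ u
  ... | yes refl =
    spread-mono (suc k) (nbrs u) (λ y∈ → y∈) (spread-mono k (nbrs-without v u) filter-⊆ x∈w)
    where
    filter-⊆ : ∀ {y} → y ∈ₗ nbrs-without v u → y ∈ₗ nbrs u
    filter-⊆ = proj₁ ∘ ∈-filter⁻ (λ x → ¬? (x ≟ v))
  ... | no w≢u   =
    branch⁺ (suc k) (∈-elements⁺ v∈Nu) (branch⁺ k (∈-filter⁺ (λ x → ¬? (x ≟ u)) w∈ w≢u) x∈w)

  walk⇒∈ball : ∀ {k u v} → Walk k u v → v ∈ₗ ball k u
  walk⇒∈ball {k} {u} stay  = centre∈spread k (nbrs u)
  walk⇒∈ball (step v∈Nu w) = ball-step _ v∈Nu (walk⇒∈ball w)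

  -- Greedy choice: a vertex joins `X` exactly when no ball around an already chosen vertex contains
  -- it. Apartness is thus recorded in one direction only, from the later choice to the earlier.
  packing : ∀ k vs → ∃[ X ] AllPairs (λ x y → x ∉ₗ ball k y) X ×
                            All (λ v → Any (λ x → v ∈ₗ ball k x) X) vs
  packing k []       = [] , [] , []
  packing k (v ∷ vs) with packing k vs
  ... | X , apart , covered with Any.any? (λ x → v ∈ₗ? ball k x) X
  ...   | yes v∈ = X , apart , v∈ ∷ covered
  ...   | no v∉  = v ∷ X , ¬Any⇒All¬ X v∉ ∷ apart ,
                   here (centre∈spread k (nbrs v)) ∷ All.map there covered

  -- Ball sizes and scattered sets in cubic graphs

  module _ (cubic : Cubic) where

    length-nbrs : ∀ v → length (nbrs v) ≡ 3
    length-nbrs v = trans (length-elements (N v)) (cubic v)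

    -- By symmetry `v` is one of the three neighbours of `w`, so the filter drops at least one.
    length-nbrs-without : ∀ {v w} → w ∈ N v → length (nbrs-without v w) ℕ.≤ 2
    length-nbrs-without {v} {w} w∈Nv = ℕ.≤-pred (subst (length (nbrs-without v w) ℕ.<_)
      (length-nbrs w) (filter-notAll _ (nbrs w) (lose (∈-elements⁺ (N-sym w∈Nv)) λ v≢v → v≢v refl)))

    binary-tree-order : ℕ → ℕ
    binary-tree-order zero    = 1
    binary-tree-order (suc k) = suc (2 ℕ.* binary-tree-order k)

    length-spread : ∀ k {v ws} → All (_∈ N v) ws → length ws ℕ.≤ 2 →
                    length (spread k v ws) ℕ.≤ binary-tree-order k

    -- Kept general in `length ws` because the centre of a ball has three branches, while every
    -- later vertex has at most two.
    length-branches : ∀ k {v ws} → All (_∈ N v) ws →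
                      length (spread (suc k) v ws) ℕ.≤ suc (length ws ℕ.* binary-tree-order k)
    length-branches k {v} ws⊆ = s≤s (length-concatMap-≤ _ (All.map (λ {w} w∈Nv →
      length-spread k (All-filter⁺ _ (elements-∈ (N w))) (length-nbrs-without w∈Nv)) ws⊆))

    length-spread zero    ws⊆ ≤2 = s≤s z≤n
    length-spread (suc k) ws⊆ ≤2 =
      ℕ.≤-trans (length-branches k ws⊆) (s≤s (ℕ.*-monoˡ-≤ (binary-tree-order k) ≤2))

    length-ball : ∀ v → length (ball 4 v) ℕ.≤ 46
    -- `binary-tree-order 3` is 15, and 1 + 3 * 15 = 46.
    length-ball v = subst (λ l → length (ball 4 v) ℕ.≤ suc (l ℕ.* binary-tree-order 3)) (length-nbrs v)
      (length-branches 3 (elements-∈ (N v)))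

    -- Walks in both directions are assumed because `packing` keeps only one of the two
    -- non-membership facts, depending on the order of choice.
    Scattered : Subset n → Set
    Scattered S = ∀ {x y} → x ∉ S → y ∉ S → Walk 4 x y → Walk 4 y x → x ≡ y

    scattered : ∃[ S ] Scattered S × (46 ℕ.* ∣ S ∣ ℕ.≤ 45 ℕ.* n)
    scattered with X , apart , covered ← packing 4 (allFin n) = excluding X , scatter , bound
      where
      ∈X : ∀ {x} → x ∉ excluding X → x ∈ₗ X
      ∈X {x} x∉ = decidable-stable (x ∈ₗ? X) (x∉ ∘ ∈-excluding⁺ X)

      scatter : Scattered (excluding X)
      scatter x∉ y∉ xy yx with ∈-AllPairs₂ apart (∈X x∉) (∈X y∉)
      ... | inj₁ x≡y         = x≡y
      ... | inj₂ (inj₁ x∉By) = contradiction (walk⇒∈ball yx) x∉By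
      ... | inj₂ (inj₂ y∉Bx) = contradiction (walk⇒∈ball xy) y∉Bx

      n≤46∣X∣ : n ℕ.≤ length X ℕ.* 46
      n≤46∣X∣ = ℕ.≤-trans
        (complete⇒n≤length (concatMap (ball 4) X)
          (λ v → ∈-concatMap⁺ _ (All.lookup covered (∈-allFin v))))
        (length-concatMap-≤ (ball 4) (All.universal length-ball X))

      unique : Unique X
      -- Apart vertices are distinct, since each lies in its own ball.
      unique = AllPairs.map (λ { {x} x∉Bx refl → x∉Bx (centre∈spread 4 (nbrs x)) }) apart

      open ℕ.≤-Reasoning

      bound : 46 ℕ.* ∣ excluding X ∣ ℕ.≤ 45 ℕ.* n
      -- Adding `n` to both sides and estimating it by 46 times the length of `X` avoids
      -- subtraction.
      bound = ℕ.+-cancelʳ-≤ n _ _ (begin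
        46 ℕ.* ∣ excluding X ∣ ℕ.+ n                  ≤⟨ ℕ.+-monoʳ-≤ (46 ℕ.* ∣ excluding X ∣) n≤46∣X∣ ⟩
        46 ℕ.* ∣ excluding X ∣ ℕ.+ length X ℕ.* 46    ≡⟨ cong (46 ℕ.* ∣ excluding X ∣ ℕ.+_) (ℕ.*-comm (length X) 46) ⟩
        46 ℕ.* ∣ excluding X ∣ ℕ.+ 46 ℕ.* length X    ≡⟨ ℕ.*-distribˡ-+ 46 ∣ excluding X ∣ (length X) ⟨
        46 ℕ.* (∣ excluding X ∣ ℕ.+ length X)         ≤⟨ ℕ.*-monoʳ-≤ 46 (∣excluding∣ unique) ⟩
        46 ℕ.* n                                      ≡⟨ ℕ.+-comm n (45 ℕ.* n) ⟩
        45 ℕ.* n ℕ.+ n                                ∎)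

    -- Scattered sets in twin-free cubic graphs

    module _ (twin-free : TwinFree) where

      -- Otherwise every neighbour of `u` other than `v` is a neighbour of `v`. Equal degrees turn
      -- the inclusion into equality, of closed neighbourhoods if `u` and `v` are adjacent and of
      -- open ones if not: twins in both cases.
      private-nbr : ∀ {u v} → u ≢ v → ∃[ p ] p ∈ N u × p ≢ v × p ∉ N v
      private-nbr {u} {v} u≢v with any? (λ p → p ∈? N u ×-dec ¬? (p ≟ v) ×-dec ¬? (p ∈? N v))
      ... | yes found = found
      ... | no ∄p     = contradiction (u≢v , twins) (twin-free u v)
        where
        p∈Nv : ∀ {p} → p ∈ N u → p ≢ v → p ∈ N v
        p∈Nv {p} p∈Nu p≢v = decidable-stable (p ∈? N v) λ p∉Nv → ∄p (p , p∈Nu , p≢v , p∉Nv)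

        ∣N[]∣ : ∀ w → ∣ N[ w ] ∣ ≡ 4
        ∣N[]∣ w = trans (∣⁅x⁆∪p∣≡1+∣p∣ N-irrefl) (cong suc (cubic w))

        twins : N[ u ] ≡ N[ v ] ⊎ N u ≡ N v
        twins with v ∈? N u
        ... | no v∉Nu  = inj₂ (⊆∧∣∣≡⇒≡
          (λ p∈Nu → p∈Nv p∈Nu λ { refl → v∉Nu p∈Nu })
          (trans (cubic u) (sym (cubic v))))
        ... | yes v∈Nu = inj₁ (⊆∧∣∣≡⇒≡ N[u]⊆N[v] (trans (∣N[]∣ u) (sym (∣N[]∣ v))))
          where
          N[u]⊆N[v] : N[ u ] ⊆ N[ v ]
          N[u]⊆N[v] {p} p∈ with x∈p∪q⁻ ⁅ u ⁆ (N u) p∈ | p ≟ v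
          ... | _        | yes refl = x∈p∪q⁺ (inj₁ (x∈⁅x⁆ v))
          ... | inj₁ p∈u | no _     rewrite x∈⁅y⁆⇒x≡y u p∈u = x∈p∪q⁺ (inj₂ (N-sym v∈Nu))
          ... | inj₂ p∈  | no p≢v   = x∈p∪q⁺ (inj₂ (p∈Nv p∈ p≢v))

      module _ {S} (scat : Scattered S) where

        -- Any two entries of `xs` are joined by a walk of length at most 1 + 2 + 1 = 4, so at most
        -- one is missing from `S`, and `three-differing` applies to the rest.
        four-differing : ∀ s s′ {u v xs t} → Walk 2 u v → 4 ℕ.≤ length xs → Unique xs →
          All (λ x → Walk 1 u x ⊎ Walk 1 v x) xs → All (Differ s s′) xs →
          Consistent S s t → ¬ Consistent S s′ t
        four-differing s s′ {u} {v} {xs} uv 4≤ uq near diff = three-differing s s′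
          (ℕ.≤-pred (ℕ.≤-trans 4≤ (length≤1+length-filter (_∈? S) uq λ x∈ y∈ x∉S y∉S →
            scat x∉S y∉S (close x∈ y∈) (close y∈ x∈))))
          (Unique-filter⁺ (_∈? S) uq) (all-filter (_∈? S) xs) (All-filter⁺ (_∈? S) diff)
          where
          via : ∀ {a b x y} → Walk 1 a x → Walk 2 a b → Walk 1 b y → Walk 4 x y
          via ax ab by = reverse₁ ax ++ʷ (ab ++ʷ by)

          close : ∀ {x y} → x ∈ₗ xs → y ∈ₗ xs → Walk 4 x y
          close x∈ y∈ with All.lookup near x∈ | All.lookup near y∈
          ... | inj₁ ux | inj₁ uy = via ux stay uy
          ... | inj₁ ux | inj₂ vy = via ux uv vy
          ... | inj₂ vx | inj₁ uy = via vx (reverse₂ uv) uy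
          ... | inj₂ vx | inj₂ vy = via vx stay vy

        -- An intruder at `u` is noticed by all four vertices of its closed neighbourhood, none of
        -- which reacts in state `s`. This treats an absent and a distant second intruder alike.
        N[]-silent : ∀ u s {t} → All (λ w → signal s w ≡ 0F) (u ∷ nbrs u) →
                     Consistent S (just u) t → ¬ Consistent S s t
        N[]-silent u s silent = four-differing (just u) s {u} stay
          (s≤s (ℕ.≤-reflexive (sym (length-nbrs u))))
          (v∷nbrs-unique u) (All.map inj₁ (nbrs-walk u))
          (All.zipWith (λ (≢0 , ≡0) eq → ≢0 (trans eq ≡0)) (signal-N[] u , silent))

        separates : ∀ u v {t} → u ≢ v → Consistent S (just u) t → ¬ Consistent S (just v) t
        separates u v u≢v with All.all? (λ w → signal (just v) w ≟ 0F) (u ∷ nbrs u)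
        ... | yes silent = N[]-silent u (just v) silent
        ... | no ¬silent
          -- Such a `w` lies in the closed neighbourhoods of both `u` and `v`, giving the walk of
          -- length 2 between them.
          with w , w∈ , ≢0 ← find (¬All⇒Any¬ (λ w → signal (just v) w ≟ 0F) (u ∷ nbrs u) ¬silent)
          with p , p∈Nu , p≢v , p∉Nv ← private-nbr u≢v
             | q , q∈Nv , q≢u , q∉Nu ← private-nbr (≢-sym u≢v) =
          four-differing (just u) (just v) {xs = u ∷ v ∷ p ∷ q ∷ []}
            (All.lookup (nbrs-walk u) w∈ ++ʷ reverse₁ (signal-walk v w ≢0))
            ℕ.≤-refl
            ((u≢v ∷ u≢p ∷ ≢-sym q≢u ∷ []) ∷ (≢-sym p≢v ∷ v≢q ∷ []) ∷ (p≢q ∷ []) ∷ [] ∷ [])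
            (inj₁ stay ∷ inj₂ stay ∷ inj₁ (step p∈Nu stay) ∷ inj₂ (step q∈Nv stay) ∷ [])
            -- At `u` and at `v` only the intruder sitting there causes signal 2; at `p` and at `q`
            -- exactly one of the two signals is 0.
            ( (λ eq → signal-other v u (≢-sym u≢v) (trans (sym eq) (signal-self u)))
            ∷ (λ eq → signal-other u v u≢v (trans eq (signal-self v)))
            ∷ (λ eq → signal-near u p p∈Nu (trans eq (signal-far v p (≢-sym p≢v) p∉Nv)))
            ∷ (λ eq → signal-near v q q∈Nv (trans (sym eq) (signal-far u q (≢-sym q≢u) q∉Nu)))
            ∷ [])
          where
          u≢p : u ≢ p
          u≢p refl = N-irrefl p∈Nu
          v≢q : v ≢ q
          v≢q refl = N-irrefl q∈Nv
          p≢q : p ≢ q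
          p≢q refl = q∉Nu p∈Nu

        scattered⇒ERRLD : IsERRLD S
        scattered⇒ERRLD t nothing  nothing  c c′ = refl
        scattered⇒ERRLD t nothing  (just v) c c′ =
          contradiction c (N[]-silent v nothing (All.universal (λ _ → refl) _) c′)
        scattered⇒ERRLD t (just u) nothing  c c′ =
          contradiction c′ (N[]-silent u nothing (All.universal (λ _ → refl) _) c)
        scattered⇒ERRLD t (just u) (just v) c c′ with u ≟ v
        ... | yes refl = refl
        ... | no u≢v   = contradiction c′ (separates u v u≢v c)

-- The minimum and its bound with denominators cleared

ERRLD-bound : (G : Graph n) → Graph.Cubic G → Graph.TwinFree G →
              ∃[ k ] Graph.ERRLD≡ G k × (46 ℕ.* k ℕ.≤ 45 ℕ.* n)
ERRLD-bound G cubic twin-free =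
  let S , scat , 46∣S∣≤45n  = scattered G cubic
      errld                 = scattered⇒ERRLD G cubic twin-free scat
      T , errldT , minimal  = smallest (IsERRLD? G) S errld
  in ∣ T ∣ , ((T , errldT , refl) , minimal) ,
     ℕ.≤-trans (ℕ.*-monoʳ-≤ 46 (minimal S errld)) 46∣S∣≤45n

-- Rational arithmetic

floor-lower : ∀ q → ℚ.floor q ℤ.* ℚ.↧ q ℤ.≤ ℚ.↥ q
floor-lower q@record{} = ℤ.[n/d]*d≤n (ℚ.↥ q) (ℚ.↧ q)

-- The ceiling is the negated floor of the negation, so this is `floor-lower` for `- q` with signs
-- reversed.
ceiling-upper : ∀ q → ℚ.↥ q ℤ.≤ ceiling q ℤ.* ℚ.↧ q
ceiling-upper q@record{} = begin
  ℚ.↥ q                                        ≡⟨ ℤ.neg-involutive (ℚ.↥ q) ⟨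
  ℤ.- (ℤ.- ℚ.↥ q)                              ≡⟨ cong ℤ.-_ (ℚ.↥-neg q) ⟨
  ℤ.- (ℚ.↥ (ℚ.- q))                            ≤⟨ ℤ.neg-mono-≤ (floor-lower (ℚ.- q)) ⟩
  ℤ.- (ℚ.floor (ℚ.- q) ℤ.* ℚ.↧ (ℚ.- q))        ≡⟨ ℤ.neg-distribˡ-* (ℚ.floor (ℚ.- q)) _ ⟩
  ceiling q ℤ.* ℚ.↧ (ℚ.- q)                    ≡⟨ cong (ceiling q ℤ.*_) (ℚ.↧-neg q) ⟩
  ceiling q ℤ.* ℚ.↧ q                          ∎
  where open ℤ.≤-Reasoning

≤⇒≤ceiling : ∀ {i q} → mkℚᵘ i 0 ℚᵘ.≤ ℚ.toℚᵘ q → i ℤ.≤ ceiling q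
≤⇒≤ceiling {i} {q@record{}} (*≤* i≤q) = ℤ.*-cancelʳ-≤-pos i (ceiling q) (ℚ.↧ q) (begin
  i ℤ.* ℚ.↧ q          ≤⟨ i≤q ⟩
  ℚ.↥ q ℤ.* ℤ.1ℤ       ≡⟨ ℤ.*-identityʳ (ℚ.↥ q) ⟩
  ℚ.↥ q                ≤⟨ ceiling-upper q ⟩
  ceiling q ℤ.* ℚ.↧ q  ∎)
  where open ℤ.≤-Reasoning

-- Normalised rationals are reduced by a gcd that does not compute for a variable numerator;
-- explicit unnormalised representatives `p′` and `q′` make the inequality a plain
-- cross-multiplication.
≤-ceiling-* : ∀ {i} p q p′ q′ → ℚ.toℚᵘ p ℚᵘ.≃ p′ → ℚ.toℚᵘ q ℚᵘ.≃ q′ →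
              mkℚᵘ i 0 ℚᵘ.≤ p′ ℚᵘ.* q′ → i ℤ.≤ ceiling (p * q)
≤-ceiling-* p q p′ q′ p≃p′ q≃q′ i≤p′q′ = ≤⇒≤ceiling {q = p * q} (ℚᵘ.≤-respʳ-≃
  (ℚᵘ.≃-sym (ℚᵘ.≃-trans (ℚ.toℚᵘ-homo-* p q) (ℚᵘ.*-cong p≃p′ q≃q′))) i≤p′q′)

≤-ceiling-45/46 : ∀ k n → 46 ℕ.* k ℕ.≤ 45 ℕ.* n → (+ k) ≤ℤ ceiling ((+ 45 / 46) * (+ n / 1))
-- `mkℚᵘ` stores the denominator minus one, so these are 45/46 and n/1.
≤-ceiling-45/46 k n 46k≤45n = ≤-ceiling-* (+ 45 / 46) (+ n / 1) (mkℚᵘ (+ 45) 45) (mkℚᵘ (+ n) 0)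
  (ℚ.toℚᵘ-fromℚᵘ (mkℚᵘ (+ 45) 45)) (ℚ.toℚᵘ-fromℚᵘ (mkℚᵘ (+ n) 0)) (*≤* cross)
  where
  cross : (+ k) ℤ.* (+ 46) ℤ.≤ (+ 45) ℤ.* (+ n) ℤ.* (+ 1)
  cross = subst₂ ℤ._≤_
    (trans (cong +_ (ℕ.*-comm 46 k)) (ℤ.pos-* k 46))
    (trans (ℤ.pos-* 45 n) (sym (ℤ.*-identityʳ _)))
    (ℤ.+≤+ 46k≤45n)

proposition4p1 : ∀ (n : ℕ) (G : Graph n) → n ≥ 46 → Graph.Cubic G → Graph.TwinFree G →
    ∃[ k ] Graph.ERRLD≡ G k × (+ k) ≤ℤ ceiling ((+ 45 / 46) * (+ n / 1))
proposition4p1 n G _ cubic twin-free =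
  let k , errld , 46k≤45n = ERRLD-bound G cubic twin-free in
  k , errld , ≤-ceiling-45/46 k n 46k≤45n
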